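{- Let $q \ge 2$ and $n \ge 1$ be integers and let $A \subset E_q^n$ be a non-empty subset. Let $k$ and $s$ be integers with $0 \le k \le n$ and $1 \le s \le p(k)$, where $p(k) = \min\{|A|, q^k\}$. Then $$\sum_{e=s}^{p(k)} \binom{e}{s} V(A,k,e) = \sum_{B \subset A,\ |B| = s} \binom{n-R(B)}{k-R(B)},$$ where the right-hand sum is over all $s$-element subsets $B$ of $A$.
   Context: $E_q = \{0,1,\dots,q-1\}$ and $E_q^n$ is the set of all $n$-dimensional vectors with coordinates in $E_q$. A $k$-dimensional face of $E_q^n$ is the set of all vectors in $E_q^n$ having prescribed fixed values in some fixed $n-k$ coordinates. The rank $R(B)$ of a non-empty subset $B \subset E_q^n$ is the dimension of the smallest face containing $B$; equivalently, it is the number of coordinates that are not constant on $B$. $V(A,k,e)$ denotes the number of $k$-dimensional faces of $E_q^n$ containing exactly $e$ elements of $A$. Convention: for integers $m \ge 0$ and $j$, $\binom{m}{j}$ is the usual binomial coefficient for $j \ge 0$, and $\binom{m}{j} = 0$ if $j < 0$. -}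

module Defs where

import Data.Bool.Properties as Bool
open import Data.Fin.Base using (Fin; finToFun)
import Data.Fin.Properties as Fin
open import Data.Fin.Subset
  using (Subset; inside; outside; ∣_∣; _∈_; _⊆_; _∩_; ∁; Nonempty)
open import Data.Fin.Subset.Properties
  using (_∈?_; _⊆?_; anySubset?; ∣∁p∣≡n∸∣p∣; ∣p∣≤n)
open import Data.Integer.Base using (ℤ; +_; -[1+_])
open import Data.List.Base
  using (List; []; _∷_; applyUpTo; cartesianProductWith; filter; length)
open import Data.Nat.Base using (ℕ; zero; suc; _+_; _∸_; _^_; _⊓_; _≤_)
import Data.Nat.Properties as ℕ
open import Data.Nat.Combinatorics using (_C_)
open import Data.Nat.ListAction using (sum)
open import Data.Product.Base using (_×_; _,_; ∃-syntax)
import Data.Vec.Base as Vec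
import Data.Vec.Properties as Vec
open import Level using (Level)
open import Relation.Binary.PropositionalEquality
  using (_≡_; refl; sym; trans; cong; subst)
open import Relation.Nullary.Decidable
  using (does; proof; dec-true; _×-dec_; _→-dec_)
open import Relation.Nullary.Reflects using (Reflects; invert)
open import Relation.Unary using (Pred; Decidable)

private
  variable
    ℓ : Level
    m : ℕ

-- Binomial coefficient with an integer lower index, zero when it is negative.
binom : ℕ → ℤ → ℕ
binom m (+ j)    = m C j
binom m -[1+ _ ] = 0

-- f a + f (a + 1) + … + f b  (empty when b < a)
sumFromTo : ℕ → ℕ → (ℕ → ℕ) → ℕ
sumFromTo a b f = sum (applyUpTo (λ d → f (a + d)) (suc b ∸ a))

setOf : {P : Pred (Fin m) ℓ} → Decidable P → Subset m
setOf P? = Vec.tabulate (λ x → does (P? x))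

∈-setOf⁺ : {P : Pred (Fin m) ℓ} (P? : Decidable P) {x : Fin m} → P x → x ∈ setOf P?
∈-setOf⁺ P? {x} px = Vec.lookup⇒[]= x _
  (trans (Vec.lookup∘tabulate _ x) (dec-true (P? x) px))

∈-setOf⁻ : {P : Pred (Fin m) ℓ} (P? : Decidable P) {x : Fin m} → x ∈ setOf P? → P x
∈-setOf⁻ P? {x} x∈ = invert (subst (Reflects _)
  (trans (sym (Vec.lookup∘tabulate _ x)) (Vec.[]=⇒lookup x∈)) (proof (P? x)))

allSubsets : ∀ m → List (Subset m)
allSubsets zero    = Vec.[] ∷ []
allSubsets (suc m) =
  cartesianProductWith Vec._∷_ (outside ∷ inside ∷ []) (allSubsets m)

subsetsOfSize : Subset m → ℕ → List (Subset m)
subsetsOfSize {m} A s =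
  filter (λ B → (B ⊆? A) ×-dec (∣ B ∣ ℕ.≟ s)) (allSubsets m)

-- The vectors in E_q^n are taken to be the elements of Fin (q ^ n), through the
-- bijection finToFun / funToFin with Fin n → Fin q.  Unlike functions, they and
-- the sets of them (Subset (q ^ n)) have an extensional propositional equality.
module _ (q n : ℕ) where

  Point : Set
  Point = Fin (q ^ n)

  coord : Point → Fin n → Fin q
  coord = finToFun

  AgreeOn : Subset n → Point → Point → Set
  AgreeOn S a x = ∀ i → i ∈ S → coord x i ≡ coord a i

  agreeOn? : ∀ S a → Decidable (AgreeOn S a)
  agreeOn? S a x = Fin.all? (λ i → (i ∈? S) →-dec (coord x i Fin.≟ coord a i))

  -- The face whose coordinates in S are fixed to the values they have in a.
  face : Subset n → Point → Subset (q ^ n)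
  face S a = setOf (agreeOn? S a)

  IsFace : ℕ → Subset (q ^ n) → Set
  IsFace k F = ∃[ S ] (∣ S ∣ + k ≡ n) × (∃[ a ] F ≡ face S a)

  isFace? : ∀ k → Decidable (IsFace k)
  isFace? k F = anySubset? λ S →
    (∣ S ∣ + k ℕ.≟ n) ×-dec Fin.any? (λ a → Vec.≡-dec Bool._≟_ F (face S a))

  -- Faces are counted as sets of vectors.
  V : Subset (q ^ n) → ℕ → ℕ → ℕ
  V A k e = length
    (filter (λ F → isFace? k F ×-dec (∣ F ∩ A ∣ ℕ.≟ e)) (allSubsets (q ^ n)))

  p : Subset (q ^ n) → ℕ → ℕ
  p A k = ∣ A ∣ ⊓ q ^ k

  ConstantOn : Subset (q ^ n) → Fin n → Set
  ConstantOn B i = ∀ x y → x ∈ B → y ∈ B → coord x i ≡ coord y i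

  constantOn? : ∀ B → Decidable (ConstantOn B)
  constantOn? B i = Fin.all? λ x → Fin.all? λ y →
    (x ∈? B) →-dec ((y ∈? B) →-dec (coord x i Fin.≟ coord y i))

  -- The number of coordinates that are not constant on B; rank-smallest shows
  -- that it is the dimension of the smallest face containing B.
  rank : Subset (q ^ n) → ℕ
  rank B = ∣ ∁ (setOf (constantOn? B)) ∣

  rank-smallest : ∀ B → Nonempty B →
    ∃[ F ] IsFace (rank B) F × B ⊆ F ×
           (∀ k G → IsFace k G → B ⊆ G → F ⊆ G)
  rank-smallest B (b , b∈B) = face S b , (S , dim , b , refl) , B⊆F , least
    where
    S : Subset n
    S = setOf (constantOn? B)

    dim : ∣ S ∣ + rank B ≡ n
    dim = trans (cong (λ r → ∣ S ∣ + r) (∣∁p∣≡n∸∣p∣ S)) (ℕ.m+[n∸m]≡n (∣p∣≤n S))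

    B⊆F : B ⊆ face S b
    B⊆F x∈B = ∈-setOf⁺ (agreeOn? S b)
      λ i i∈S → ∈-setOf⁻ (constantOn? B) i∈S _ _ x∈B b∈B

    least : ∀ k G → IsFace k G → B ⊆ G → face S b ⊆ G
    least k _ (T , _ , a , refl) B⊆G x∈F = ∈-setOf⁺ (agreeOn? T a) λ i i∈T →
      trans (∈-setOf⁻ (agreeOn? S b) x∈F i (∈-setOf⁺ (constantOn? B)
              λ y z y∈B z∈B → trans (onB y∈B i i∈T) (sym (onB z∈B i i∈T))))
            (onB b∈B i i∈T)
      where
      onB : ∀ {y} → y ∈ B → AgreeOn T a y
      onB y∈B = ∈-setOf⁻ (agreeOn? T a) (B⊆G y∈B)

{-# OPTIONS --safe #-}
module Submission where

-- Count the pairs (F , B) of a k-face F and an s-subset B of A ∩ F in two ways.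
-- A face F contributes |F ∩ A| C s, and |F ∩ A| ≤ p(k) because |F| ≤ q ^ k.  A set
-- B containing b contributes the faces through b whose set of fixed coordinates
-- is an (n − k)-subset of the n − R(B) coordinates constant on B.  As q ≥ 2,
-- distinct sets of fixed coordinates give distinct faces through b, so there are
-- (n − R(B)) C (n − k) of them.

open import Defs
import Algebra.Properties.CommutativeSemigroup as CommutativeSemigroup
open import Data.Bool.Base using (Bool; true; false)
open import Data.Fin.Base
  using (Fin; zero; suc; combine; fromℕ<; funToFin; finToFun; punchIn)
import Data.Fin.Properties as Fin
open import Data.Fin.Subset
  using (Subset; Nonempty; inside; outside; ∣_∣; _∈_; _⊆_; _∩_; ∁)
open import Data.Fin.Subset.Properties
  using ( _∈?_; _⊆?_; drop-∷-⊆; out⊆; s⊆s; ⊆-antisym; ⊆-trans; ∣∁p∣≡n∸∣p∣; ∣p∣≤n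
        ; x∉p⇒x∈∁p; p∩q⊆p; p∩q⊆q; x∈p∩q⁺; ∣p∩q∣≤∣p∣; ∣p∩q∣≤∣q∣)
open import Data.Integer.Base using (_⊖_)
import Data.Integer.Properties as ℤ
open import Data.List.Base
  using (List; []; _∷_; _++_; map; filter; length; applyUpTo)
open import Data.List.Membership.Propositional using () renaming (_∈_ to _∈ˡ_)
open import Data.List.Membership.Propositional.Properties
  using ( ∈-map⁺; ∈-map⁻; ∈-filter⁺; ∈-filter⁻; ∈-applyUpTo⁺; ∈-cartesianProductWith⁺)
open import Data.List.Membership.Propositional.Properties.WithK using (unique∧set⇒bag)
open import Data.List.Properties
  using ( filter-++; filter-none; filter-≐; length-++; length-map; ++-identityʳ
        ; map-applyUpTo; map-cong; map-cong-local)
open import Data.List.Relation.Binary.BagAndSetEquality using (∼bag⇒↭)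
open import Data.List.Relation.Binary.Permutation.Propositional.Properties using (↭-length)
open import Data.List.Relation.Unary.All as All using (All; []; _∷_)
open import Data.List.Relation.Unary.AllPairs.Core using ([]; _∷_)
open import Data.List.Relation.Unary.Any using (here; there)
open import Data.List.Relation.Unary.Unique.Propositional using (Unique)
import Data.List.Relation.Unary.Unique.Propositional.Properties as Unique
open import Data.Nat.Base
  using (ℕ; zero; suc; _+_; _*_; _∸_; _^_; _≤_; _<_; s≤s)
open import Data.Nat.Combinatorics
  using (_C_; nCk≡nC[n∸k]; nCk+nC[k+1]≡[n+1]C[k+1]; k>n⇒nCk≡0)
open import Data.Nat.ListAction using (sum)
import Data.Nat.Properties as ℕ
open import Data.Nat.Properties using (_≟_; _≤?_)
open import Data.Product.Base using (_×_; _,_; proj₂; ∃-syntax)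
open import Data.Sum.Base using (_⊎_; inj₁; inj₂)
open import Data.Vec.Base as Vec using ([]; _∷_)
open import Data.Vec.Functional using (updateAt)
open import Data.Vec.Functional.Properties using (updateAt-updates; updateAt-minimal)
import Data.Vec.Properties as Vec
open import Function.Base using (_∘_; const; case_of_)
open import Function.Bundles using (_⇔_; mk⇔)
open import Level using (Level)
open import Relation.Binary.PropositionalEquality
  using (_≡_; _≢_; refl; sym; trans; cong; cong₂; subst; module ≡-Reasoning)
open import Relation.Nullary.Decidable
  using (Dec; yes; no; does; _×-dec_; dec-true; dec-false; decidable-stable)
open import Relation.Nullary.Negation using (contradiction)
open import Relation.Unary using (Pred; Decidable)

private
  variable
    a b ℓ ℓ′ : Level
    X : Set a
    Y : Set b
    m n : ℕ

-- Counting in lists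

𝟙 : Bool → ℕ
𝟙 true  = 1
𝟙 false = 0

-- Writing a count as a sum of indicators makes exchange of summation available for counts.
length-filter : {P : Pred X ℓ} (P? : Decidable P) (xs : List X) →
                length (filter P? xs) ≡ sum (map (λ x → 𝟙 (does (P? x))) xs)
length-filter P? []       = refl
length-filter P? (x ∷ xs) with does (P? x)
... | true  = cong suc (length-filter P? xs)
... | false = length-filter P? xs

length-filter-map : {P : Pred Y ℓ} (P? : Decidable P) (f : X → Y) (xs : List X) →
                    length (filter P? (map f xs)) ≡ length (filter (P? ∘ f) xs)
length-filter-map P? f []       = refl
length-filter-map P? f (x ∷ xs) with does (P? (f x))
... | true  = cong suc (length-filter-map P? f xs)
... | false = length-filter-map P? f xs

-- `V` and `subsetsOfSize` filter once, by a conjunction; this separates the two conditions, so that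
-- the faces or subsets can be fixed first and then sorted.
filter-filter : {P : Pred X ℓ} {Q : Pred X ℓ′}
                (P? : Decidable P) (Q? : Decidable Q) (xs : List X) →
                filter Q? (filter P? xs) ≡ filter (λ x → P? x ×-dec Q? x) xs
filter-filter P? Q? []       = refl
filter-filter P? Q? (x ∷ xs) with does (P? x)
... | false = filter-filter P? Q? xs
... | true with does (Q? x)
...   | true  = cong (x ∷_) (filter-filter P? Q? xs)
...   | false = filter-filter P? Q? xs

sum-map-zero : {f : X → ℕ} → (∀ x → f x ≡ 0) → ∀ xs → sum (map f xs) ≡ 0
sum-map-zero f≡0 []       = refl
sum-map-zero f≡0 (x ∷ xs) = cong₂ _+_ (f≡0 x) (sum-map-zero f≡0 xs)

sum-map-+ : (f g : X → ℕ) (xs : List X) →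
            sum (map (λ x → f x + g x) xs) ≡ sum (map f xs) + sum (map g xs)
sum-map-+ f g []       = refl
sum-map-+ f g (x ∷ xs) = begin
  (f x + g x) + sum (map (λ x → f x + g x) xs)  ≡⟨ cong ((f x + g x) +_) (sum-map-+ f g xs) ⟩
  (f x + g x) + (sum (map f xs) + sum (map g xs))
    ≡⟨ CommutativeSemigroup.interchange ℕ.+-commutativeSemigroup
         (f x) (g x) (sum (map f xs)) (sum (map g xs)) ⟩
  (f x + sum (map f xs)) + (g x + sum (map g xs)) ∎
  where
  open ≡-Reasoning

sum-map-*ˡ : ∀ c (f : X → ℕ) xs → sum (map (λ x → c * f x) xs) ≡ c * sum (map f xs)
sum-map-*ˡ c f []       = sym (ℕ.*-zeroʳ c)
sum-map-*ˡ c f (x ∷ xs) =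
  trans (cong (c * f x +_) (sum-map-*ˡ c f xs)) (sym (ℕ.*-distribˡ-+ c (f x) _))

sum-map-comm : (h : X → Y → ℕ) (xs : List X) (ys : List Y) →
               sum (map (λ x → sum (map (h x) ys)) xs) ≡
               sum (map (λ y → sum (map (λ x → h x y) xs)) ys)
sum-map-comm h []       ys = sym (sum-map-zero (λ _ → refl) ys)
sum-map-comm h (x ∷ xs) ys =
  trans (cong (sum (map (h x) ys) +_) (sum-map-comm h xs ys))
        (sym (sum-map-+ (h x) (λ y → sum (map (λ x → h x y) xs)) ys))

-- Each side adds up the indicator of `R` over all pairs, by rows on the left and by columns on the
-- right.
double-counting : {R : X → Y → Set ℓ} (R? : ∀ x y → Dec (R x y))
                  (xs : List X) (ys : List Y) →
                  sum (map (λ x → length (filter (R? x) ys)) xs) ≡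
                  sum (map (λ y → length (filter (λ x → R? x y) xs)) ys)
double-counting R? xs ys = begin
  sum (map (λ x → length (filter (R? x) ys)) xs)
    ≡⟨ cong sum (map-cong (λ x → length-filter (R? x) ys) xs) ⟩
  sum (map (λ x → sum (map (λ y → 𝟙 (does (R? x y))) ys)) xs)
    ≡⟨ sum-map-comm (λ x y → 𝟙 (does (R? x y))) xs ys ⟩
  sum (map (λ y → sum (map (λ x → 𝟙 (does (R? x y))) xs)) ys)
    ≡⟨ cong sum (map-cong (λ y → length-filter (λ x → R? x y) xs) ys) ⟨
  sum (map (λ y → length (filter (λ x → R? x y) xs)) ys) ∎
  where open ≡-Reasoning

module _ (g : ℕ → ℕ) where

  private
    -- Supported on `e = v`, so that summing over `e` picks out `g v`.
    term : ℕ → ℕ → ℕ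
    term v e = g e * 𝟙 (does (v ≟ e))

    term-≡ : ∀ v → term v v ≡ g v
    term-≡ v rewrite dec-true (v ≟ v) refl = ℕ.*-identityʳ (g v)

    term-≢ : ∀ {v e} → v ≢ e → term v e ≡ 0
    term-≢ {v} {e} v≢e rewrite dec-false (v ≟ e) v≢e = ℕ.*-zeroʳ (g e)

    sum-term-∉ : ∀ {v es} → All (v ≢_) es → sum (map (term v) es) ≡ 0
    sum-term-∉ []           = refl
    sum-term-∉ (v≢e ∷ v∉es) = cong₂ _+_ (term-≢ v≢e) (sum-term-∉ v∉es)

    sum-term-∈ : ∀ {v es} → Unique es → v ∈ˡ es → sum (map (term v) es) ≡ g v
    sum-term-∈ {v} (e∉es ∷ _) (here refl) =
      trans (cong₂ _+_ (term-≡ v) (sum-term-∉ e∉es)) (ℕ.+-identityʳ (g v))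
    sum-term-∈ (e∉es ∷ es!) (there v∈es) =
      cong₂ _+_ (term-≢ (All.lookup e∉es v∈es ∘ sym)) (sum-term-∈ es! v∈es)

    sum-term-0 : ∀ {v} → g v ≡ 0 → ∀ es → sum (map (term v) es) ≡ 0
    sum-term-0 {v} gv≡0 = sum-map-zero λ e → case v ≟ e of λ where
      (yes refl) → trans (term-≡ v) gv≡0
      (no v≢e)   → term-≢ v≢e

  -- After exchanging the two sums, each `x` meets its own value `f x` exactly once in `es`, since
  -- `es` has no repetitions. A value missing from `es` is harmless when its weight is zero; this is
  -- what allows the sum over `e` to start at `s`.
  sum-by-value : (f : X → ℕ) (xs : List X) {es : List ℕ} → Unique es →
                 (∀ {x} → x ∈ˡ xs → f x ∈ˡ es ⊎ g (f x) ≡ 0) →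
                 sum (map (λ e → g e * length (filter (λ x → f x ≟ e) xs)) es) ≡
                 sum (map (λ x → g (f x)) xs)
  sum-by-value f xs {es} es! covered = begin
    sum (map (λ e → g e * length (filter (λ x → f x ≟ e) xs)) es)
      ≡⟨ cong sum (map-cong (λ e →
           trans (cong (g e *_) (length-filter (λ x → f x ≟ e) xs))
                 (sym (sum-map-*ˡ (g e) (λ x → 𝟙 (does (f x ≟ e))) xs))) es) ⟩
    sum (map (λ e → sum (map (λ x → term (f x) e) xs)) es)
      ≡⟨ sum-map-comm (λ e x → term (f x) e) es xs ⟩
    sum (map (λ x → sum (map (term (f x)) es)) xs)
      ≡⟨ cong sum (map-cong-local (All.tabulate λ x∈xs → inner (covered x∈xs))) ⟩
    sum (map (λ x → g (f x)) xs) ∎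
    where
    open ≡-Reasoning

    inner : ∀ {v} → v ∈ˡ es ⊎ g v ≡ 0 → sum (map (term v) es) ≡ g v
    inner (inj₁ v∈es) = sum-term-∈ es! v∈es
    inner (inj₂ gv≡0) = trans (sum-term-0 gv≡0 es) (sym gv≡0)

-- Without repetitions, equality as sets is equality as bags, so each list is a permutation of the
-- other. This is how a bijection between finite families is turned into an equality of counts.
unique∧set⇒length : {xs ys : List X} → Unique xs → Unique ys →
                    (∀ {z} → z ∈ˡ xs ⇔ z ∈ˡ ys) → length xs ≡ length ys
unique∧set⇒length xs! ys! xs⇔ys = ↭-length (∼bag⇒↭ (unique∧set⇒bag xs! ys! xs⇔ys))

-- Subsets of a finite set

∈-allSubsets : (S : Subset m) → S ∈ˡ allSubsets m
∈-allSubsets []            = here refl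
∈-allSubsets (outside ∷ S) =
  ∈-cartesianProductWith⁺ Vec._∷_ {xs = outside ∷ inside ∷ []} (here refl) (∈-allSubsets S)
∈-allSubsets (inside ∷ S)  =
  ∈-cartesianProductWith⁺ Vec._∷_ {xs = outside ∷ inside ∷ []}
    (there (here refl)) (∈-allSubsets S)

allSubsets-! : ∀ m → Unique (allSubsets m)
allSubsets-! zero    = [] ∷ []
allSubsets-! (suc m) =
  Unique.cartesianProductWith⁺ Vec._∷_ Vec.∷-injective
    (((λ ()) ∷ []) ∷ [] ∷ []) (allSubsets-! m)

∈-subsetsOfSize⁺ : {D B : Subset m} {s : ℕ} → B ⊆ D → ∣ B ∣ ≡ s → B ∈ˡ subsetsOfSize D s
∈-subsetsOfSize⁺ {D = D} {B} {s} B⊆D ∣B∣≡s =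
  ∈-filter⁺ (λ B → (B ⊆? D) ×-dec (∣ B ∣ ≟ s)) (∈-allSubsets B) (B⊆D , ∣B∣≡s)

∈-subsetsOfSize⁻ : {D B : Subset m} {s : ℕ} → B ∈ˡ subsetsOfSize D s → B ⊆ D × ∣ B ∣ ≡ s
∈-subsetsOfSize⁻ {m} {D = D} {s = s} B∈ =
  proj₂ (∈-filter⁻ (λ B → (B ⊆? D) ×-dec (∣ B ∣ ≟ s)) {xs = allSubsets m} B∈)

subsetsOfSize-! : (D : Subset m) (s : ℕ) → Unique (subsetsOfSize D s)
subsetsOfSize-! D s = Unique.filter⁺ _ (allSubsets-! _)

-- Splits on whether the first element belongs to the subset, the case distinction behind Pascal's
-- rule.
length-filter-allSubsets-suc :
  {P : Pred (Subset (suc m)) ℓ} (P? : Decidable P) →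
  length (filter P? (allSubsets (suc m))) ≡
  length (filter (P? ∘ (outside Vec.∷_)) (allSubsets m)) +
  length (filter (P? ∘ (inside Vec.∷_)) (allSubsets m))
length-filter-allSubsets-suc {m = m} P? = begin
  length (filter P? (outs ++ ins ++ []))
    ≡⟨ cong (λ zs → length (filter P? (outs ++ zs))) (++-identityʳ ins) ⟩
  length (filter P? (outs ++ ins))              ≡⟨ cong length (filter-++ P? outs ins) ⟩
  length (filter P? outs ++ filter P? ins)      ≡⟨ length-++ (filter P? outs) ⟩
  length (filter P? outs) + length (filter P? ins)
    ≡⟨ cong₂ _+_ (length-filter-map P? (outside Vec.∷_) (allSubsets m))
                 (length-filter-map P? (inside Vec.∷_) (allSubsets m)) ⟩
  length (filter (P? ∘ (outside Vec.∷_)) (allSubsets m)) +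
  length (filter (P? ∘ (inside Vec.∷_)) (allSubsets m)) ∎
  where
  open ≡-Reasoning
  outs ins : List (Subset (suc m))
  outs = map (outside Vec.∷_) (allSubsets m)
  ins  = map (inside Vec.∷_) (allSubsets m)

filter-outside : ∀ t (D : Subset m) s →
  filter (λ B → ((outside ∷ B) ⊆? (t ∷ D)) ×-dec (∣ B ∣ ≟ s)) (allSubsets m) ≡
  subsetsOfSize D s
filter-outside t D s = filter-≐ _ _ (to , from) (allSubsets _)
  where
  to : ∀ {B} → (outside ∷ B) ⊆ (t ∷ D) × ∣ B ∣ ≡ s → B ⊆ D × ∣ B ∣ ≡ s
  to (B⊆D , ∣B∣≡s) = drop-∷-⊆ B⊆D , ∣B∣≡s

  from : ∀ {B} → B ⊆ D × ∣ B ∣ ≡ s → (outside ∷ B) ⊆ (t ∷ D) × ∣ B ∣ ≡ s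
  from (B⊆D , ∣B∣≡s) = out⊆ B⊆D , ∣B∣≡s

filter-inside : ∀ (D : Subset m) s →
  filter (λ B → ((inside ∷ B) ⊆? (inside ∷ D)) ×-dec (suc ∣ B ∣ ≟ suc s)) (allSubsets m) ≡
  subsetsOfSize D s
filter-inside D s = filter-≐ _ _ (to , from) (allSubsets _)
  where
  to : ∀ {B} → (inside ∷ B) ⊆ (inside ∷ D) × suc ∣ B ∣ ≡ suc s → B ⊆ D × ∣ B ∣ ≡ s
  to (B⊆D , ∣B∣≡s) = drop-∷-⊆ B⊆D , ℕ.suc-injective ∣B∣≡s

  from : ∀ {B} → B ⊆ D × ∣ B ∣ ≡ s → (inside ∷ B) ⊆ (inside ∷ D) × suc ∣ B ∣ ≡ suc s
  from (B⊆D , ∣B∣≡s) = s⊆s B⊆D , cong suc ∣B∣≡s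

-- Induction along `D`. If the first element is not in `D`, no subset of `D` contains it; if it is,
-- the subsets avoiding it and those containing it give the two terms of Pascal's rule.
length-subsetsOfSize : (D : Subset m) (s : ℕ) → length (subsetsOfSize D s) ≡ ∣ D ∣ C s
length-subsetsOfSize []            zero    = refl
length-subsetsOfSize []            (suc s) = refl
length-subsetsOfSize {suc m} (outside ∷ D) s = begin
  length (subsetsOfSize (outside ∷ D) s)  ≡⟨ length-filter-allSubsets-suc P? ⟩
  length (filter (P? ∘ (outside Vec.∷_)) (allSubsets m)) +
  length (filter (P? ∘ (inside Vec.∷_)) (allSubsets m))
    ≡⟨ cong₂ (λ xs ys → length xs + length ys)
         (filter-outside outside D s)
         (filter-none (P? ∘ (inside Vec.∷_))
           (All.universal (λ _ (B⊆D , _) → case B⊆D Vec.here of λ ()) (allSubsets m))) ⟩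
  length (subsetsOfSize D s) + 0          ≡⟨ ℕ.+-identityʳ _ ⟩
  length (subsetsOfSize D s)              ≡⟨ length-subsetsOfSize D s ⟩
  ∣ D ∣ C s                               ∎
  where
  open ≡-Reasoning
  P? : Decidable (λ B → B ⊆ (outside ∷ D) × ∣ B ∣ ≡ s)
  P? B = (B ⊆? (outside ∷ D)) ×-dec (∣ B ∣ ≟ s)
length-subsetsOfSize {suc m} (inside ∷ D) zero = begin
  length (subsetsOfSize (inside ∷ D) 0)   ≡⟨ length-filter-allSubsets-suc P? ⟩
  length (filter (P? ∘ (outside Vec.∷_)) (allSubsets m)) +
  length (filter (P? ∘ (inside Vec.∷_)) (allSubsets m))
    ≡⟨ cong₂ (λ xs ys → length xs + length ys)
         (filter-outside inside D 0)
         (filter-none (P? ∘ (inside Vec.∷_))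
           (All.universal (λ _ ()) (allSubsets m))) ⟩
  length (subsetsOfSize D 0) + 0          ≡⟨ ℕ.+-identityʳ _ ⟩
  length (subsetsOfSize D 0)              ≡⟨ length-subsetsOfSize D 0 ⟩
  1                                       ∎
  where
  open ≡-Reasoning
  P? : Decidable (λ B → B ⊆ (inside ∷ D) × ∣ B ∣ ≡ 0)
  P? B = (B ⊆? (inside ∷ D)) ×-dec (∣ B ∣ ≟ 0)
length-subsetsOfSize {suc m} (inside ∷ D) (suc s) = begin
  length (subsetsOfSize (inside ∷ D) (suc s))  ≡⟨ length-filter-allSubsets-suc P? ⟩
  length (filter (P? ∘ (outside Vec.∷_)) (allSubsets m)) +
  length (filter (P? ∘ (inside Vec.∷_)) (allSubsets m))
    ≡⟨ cong₂ (λ xs ys → length xs + length ys)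
         (filter-outside inside D (suc s))
         (filter-inside D s) ⟩
  length (subsetsOfSize D (suc s)) + length (subsetsOfSize D s)
    ≡⟨ cong₂ _+_ (length-subsetsOfSize D (suc s)) (length-subsetsOfSize D s) ⟩
  ∣ D ∣ C suc s + ∣ D ∣ C s  ≡⟨ ℕ.+-comm (∣ D ∣ C suc s) _ ⟩
  ∣ D ∣ C s + ∣ D ∣ C suc s  ≡⟨ nCk+nC[k+1]≡[n+1]C[k+1] ∣ D ∣ s ⟩
  suc ∣ D ∣ C suc s          ∎
  where
  open ≡-Reasoning
  P? : Decidable (λ B → B ⊆ (inside ∷ D) × ∣ B ∣ ≡ suc s)
  P? B = (B ⊆? (inside ∷ D)) ×-dec (∣ B ∣ ≟ suc s)

-- The sets counted are exactly the `s`-subsets of `F ∩ A`. This is the contribution of one face to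
-- the double count.
length-subsetsOfSize-⊆ : (A : Subset m) (s : ℕ) (F : Subset m) →
  length (filter (_⊆? F) (subsetsOfSize A s)) ≡ ∣ F ∩ A ∣ C s
length-subsetsOfSize-⊆ {m} A s F = begin
  length (filter (_⊆? F) (subsetsOfSize A s))
    ≡⟨ cong length (filter-filter _ (_⊆? F) (allSubsets m)) ⟩
  length (filter (λ B → ((B ⊆? A) ×-dec (∣ B ∣ ≟ s)) ×-dec (B ⊆? F)) (allSubsets m))
    ≡⟨ cong length (filter-≐ _ _ (to , from) (allSubsets m)) ⟩
  length (subsetsOfSize (F ∩ A) s)  ≡⟨ length-subsetsOfSize (F ∩ A) s ⟩
  ∣ F ∩ A ∣ C s                     ∎
  where
  open ≡-Reasoning

  to : ∀ {B} → (B ⊆ A × ∣ B ∣ ≡ s) × B ⊆ F → B ⊆ F ∩ A × ∣ B ∣ ≡ s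
  to ((B⊆A , ∣B∣≡s) , B⊆F) = (λ x∈B → x∈p∩q⁺ (B⊆F x∈B , B⊆A x∈B)) , ∣B∣≡s

  from : ∀ {B} → B ⊆ F ∩ A × ∣ B ∣ ≡ s → (B ⊆ A × ∣ B ∣ ≡ s) × B ⊆ F
  from (B⊆F∩A , ∣B∣≡s) =
    (⊆-trans B⊆F∩A (p∩q⊆q F A) , ∣B∣≡s) , ⊆-trans B⊆F∩A (p∩q⊆p F A)

-- The increasing enumeration of `S`. It identifies `S` with `Fin ∣ S ∣`, so that sizes can be
-- compared through injections between `Fin` types.
nth : (S : Subset n) → Fin ∣ S ∣ → Fin n
nth (outside ∷ S) i       = suc (nth S i)
nth (inside ∷ S)  zero    = zero
nth (inside ∷ S)  (suc i) = suc (nth S i)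

nth-∈ : (S : Subset n) (i : Fin ∣ S ∣) → nth S i ∈ S
nth-∈ (outside ∷ S) i       = Vec.there (nth-∈ S i)
nth-∈ (inside ∷ S)  zero    = Vec.here
nth-∈ (inside ∷ S)  (suc i) = Vec.there (nth-∈ S i)

nth-injective : (S : Subset n) {i j : Fin ∣ S ∣} → nth S i ≡ nth S j → i ≡ j
nth-injective (outside ∷ S)                  eq = nth-injective S (Fin.suc-injective eq)
nth-injective (inside ∷ S)  {zero}  {zero}   eq = refl
nth-injective (inside ∷ S)  {suc i} {suc j}  eq =
  cong suc (nth-injective S (Fin.suc-injective eq))

nth-surjective : (S : Subset n) {x : Fin n} → x ∈ S → ∃[ i ] nth S i ≡ x
nth-surjective (inside ∷ S)  Vec.here        = zero , refl
nth-surjective (inside ∷ S)  (Vec.there x∈S) =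
  let i , eq = nth-surjective S x∈S in suc i , cong suc eq
nth-surjective (outside ∷ S) (Vec.there x∈S) =
  let i , eq = nth-surjective S x∈S in i , cong suc eq

-- Faces

funToFin-cong : {f g : Fin m → Fin n} → (∀ i → f i ≡ g i) → funToFin f ≡ funToFin g
funToFin-cong {zero}  f≗g = refl
funToFin-cong {suc m} f≗g = cong₂ combine (f≗g zero) (funToFin-cong (f≗g ∘ suc))

-- The one place where `q ≥ 2` enters: a coordinate that is not fixed can really be changed.
other-value : 2 ≤ n → (v : Fin n) → ∃[ w ] w ≢ v
other-value (s≤s (s≤s _)) v = punchIn v zero , Fin.punchInᵢ≢i v zero

module _ (q n : ℕ) where

  private
    variable
      B F : Subset (q ^ n)
      S T : Subset n
      x y c : Point q n
      k : ℕ

  coord-injective : (∀ i → coord q n x i ≡ coord q n y i) → x ≡ y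
  coord-injective {x} {y} eq = begin
    x                        ≡⟨ Fin.funToFin-finToFin {n} {q} x ⟨
    funToFin (coord q n x)   ≡⟨ funToFin-cong eq ⟩
    funToFin (coord q n y)   ≡⟨ Fin.funToFin-finToFin {n} {q} y ⟩
    y                        ∎
    where open ≡-Reasoning

  ∈-face⁺ : AgreeOn q n S c x → x ∈ face q n S c
  ∈-face⁺ {S} {c} = ∈-setOf⁺ (agreeOn? q n S c)

  ∈-face⁻ : x ∈ face q n S c → AgreeOn q n S c x
  ∈-face⁻ {S = S} {c = c} = ∈-setOf⁻ (agreeOn? q n S c)

  -- Any point of a face can serve as its base point, so all faces through a given point can be
  -- based at that point.
  face-centre : AgreeOn q n S c x → face q n S c ≡ face q n S x
  face-centre {S} {c} {x} agree = ⊆-antisym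
    (λ y∈ → ∈-face⁺ λ i i∈S → trans (∈-face⁻ y∈ i i∈S) (sym (agree i i∈S)))
    (λ y∈ → ∈-face⁺ λ i i∈S → trans (∈-face⁻ y∈ i i∈S) (agree i i∈S))

  -- A point of the face is determined by its coordinates outside `S`, so reading these off injects
  -- the face into the vectors of length `∣ ∁ S ∣`.
  ∣face∣≤ : ∀ S c → ∣ face q n S c ∣ ≤ q ^ ∣ ∁ S ∣
  ∣face∣≤ S c = Fin.injective⇒≤ {f = free} free-injective
    where
    F′ : Subset (q ^ n)
    F′ = face q n S c

    restrict : Point q n → Fin ∣ ∁ S ∣ → Fin q
    restrict x j = coord q n x (nth (∁ S) j)

    free : Fin ∣ F′ ∣ → Fin (q ^ ∣ ∁ S ∣)
    free u = funToFin (restrict (nth F′ u))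

    free-injective : ∀ {u v} → free u ≡ free v → u ≡ v
    free-injective {u} {v} eq = nth-injective F′ (coord-injective same)
      where
      on-∁ : ∀ j → restrict (nth F′ u) j ≡ restrict (nth F′ v) j
      on-∁ j = trans (sym (Fin.finToFun-funToFin (restrict (nth F′ u)) j))
        (trans (cong (λ w → finToFun w j) eq) (Fin.finToFun-funToFin (restrict (nth F′ v)) j))

      same : ∀ i → coord q n (nth F′ u) i ≡ coord q n (nth F′ v) i
      -- On `S` both points agree with the base point `c`; off `S` their coordinates are recorded in
      -- the common code.
      same i with i ∈? S
      ... | yes i∈S = trans (∈-face⁻ (nth-∈ F′ u) i i∈S) (sym (∈-face⁻ (nth-∈ F′ v) i i∈S))
      ... | no  i∉S with j , refl ← nth-surjective (∁ S) (x∉p⇒x∈∁p i∉S) = on-∁ j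

  ∣k-face∣≤ : IsFace q n k F → ∣ F ∣ ≤ q ^ k
  ∣k-face∣≤ {k} (S , dim , c , refl) =
    subst (λ d → ∣ face q n S c ∣ ≤ q ^ d) ∣∁S∣≡k (∣face∣≤ S c)
    where
    ∣∁S∣≡k : ∣ ∁ S ∣ ≡ k
    ∣∁S∣≡k = trans (∣∁p∣≡n∸∣p∣ S) (trans (cong (_∸ ∣ S ∣) (sym dim)) (ℕ.m+n∸m≡n ∣ S ∣ k))

  faces : ℕ → List (Subset (q ^ n))
  faces k = filter (isFace? q n k) (allSubsets (q ^ n))

  module _ (2≤q : 2 ≤ q) where

    -- If i ∈ S were free in the first face, changing the i-th coordinate of x
    -- alone would leave the second face.
    face-⊆⁻ : face q n T x ⊆ face q n S x → S ⊆ T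
    face-⊆⁻ {T} {x} {S} F⊆G {i} i∈S = decidable-stable (i ∈? T) λ i∉T →
      let w , w≢xᵢ = other-value 2≤q (coord q n x i)
          f        = updateAt (coord q n x) i (const w)
          y        = funToFin f
          y∈F      = ∈-face⁺ {S = T} {c = x} {x = y} λ j j∈T →
            trans (Fin.finToFun-funToFin f j)
              (updateAt-minimal j i (coord q n x) λ { refl → i∉T j∈T })
      in w≢xᵢ (trans (sym (updateAt-updates i (coord q n x)))
               (trans (sym (Fin.finToFun-funToFin f i)) (∈-face⁻ (F⊆G y∈F) i i∈S)))

    -- For faces based at one point, inclusion of the faces reverses inclusion of the fixed
    -- coordinate sets, so equality gives both inclusions.
    face-injective : face q n S x ≡ face q n T x → S ≡ T
    face-injective eq = ⊆-antisym
      (face-⊆⁻ λ y∈ → subst (_ ∈_) (sym eq) y∈)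
      (face-⊆⁻ λ y∈ → subst (_ ∈_) eq y∈)

    -- A face containing `B` passes through `x`, so it is `face q n S x` for some `S` of size
    -- `n ∸ k`. It contains `B` exactly when every coordinate in `S` is constant on `B`. Hence
    -- `S ↦ face q n S x` is a bijection from the `(n ∸ k)`-subsets of the constant coordinates to
    -- these faces.
    length-faces-⊇ : k ≤ n → x ∈ B →
      length (filter (B ⊆?_) (faces k)) ≡ ∣ setOf (constantOn? q n B) ∣ C (n ∸ k)
    length-faces-⊇ {k} {x} {B} k≤n x∈B = begin
      length (filter (B ⊆?_) (faces k))
        ≡⟨ unique∧set⇒length
             (Unique.filter⁺ (B ⊆?_) (Unique.filter⁺ (isFace? q n k) (allSubsets-! (q ^ n))))
             (Unique.map⁺ face-injective (subsetsOfSize-! K (n ∸ k)))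
             (mk⇔ to from) ⟩
      length (map (λ S → face q n S x) (subsetsOfSize K (n ∸ k)))
        ≡⟨ length-map (λ S → face q n S x) (subsetsOfSize K (n ∸ k)) ⟩
      length (subsetsOfSize K (n ∸ k))  ≡⟨ length-subsetsOfSize K (n ∸ k) ⟩
      ∣ K ∣ C (n ∸ k)                   ∎
      where
      open ≡-Reasoning
      K : Subset n
      K = setOf (constantOn? q n B)

      to : ∀ {F} → F ∈ˡ filter (B ⊆?_) (faces k) →
           F ∈ˡ map (λ S → face q n S x) (subsetsOfSize K (n ∸ k))
      to F∈ with F∈faces , B⊆F ← ∈-filter⁻ (B ⊆?_) {xs = faces k} F∈
            with _ , S , dim , c , refl ← ∈-filter⁻ (isFace? q n k) {xs = allSubsets (q ^ n)} F∈faces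
        -- The face arrives with an arbitrary base point `c` and is rebased at `x`.
        = subst (_∈ˡ _) (sym (face-centre (∈-face⁻ (B⊆F x∈B))))
            (∈-map⁺ _ (∈-subsetsOfSize⁺
              (λ i∈S → ∈-setOf⁺ (constantOn? q n B) λ y z y∈B z∈B →
                trans (∈-face⁻ (B⊆F y∈B) _ i∈S) (sym (∈-face⁻ (B⊆F z∈B) _ i∈S)))
              (trans (sym (ℕ.m+n∸n≡m ∣ S ∣ k)) (cong (_∸ k) dim))))

      from : ∀ {F} → F ∈ˡ map (λ S → face q n S x) (subsetsOfSize K (n ∸ k)) →
             F ∈ˡ filter (B ⊆?_) (faces k)
      from F∈ with S , S∈ , refl ← ∈-map⁻ _ F∈
              with S⊆K , ∣S∣≡ ← ∈-subsetsOfSize⁻ {D = K} S∈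
        = ∈-filter⁺ (B ⊆?_)
            (∈-filter⁺ (isFace? q n k) (∈-allSubsets _)
              (S , trans (cong (_+ k) ∣S∣≡) (ℕ.m∸n+n≡m k≤n) , x , refl))
            (λ y∈B → ∈-face⁺ λ i i∈S →
              ∈-setOf⁻ (constantOn? q n B) (S⊆K i∈S) _ _ y∈B x∈B)

-- Binomial coefficients with an integer lower index

C≡binom : ∀ {n k r} → k ≤ n → r ≤ n → (n ∸ r) C (n ∸ k) ≡ binom (n ∸ r) (k ⊖ r)
C≡binom {n} {k} {r} k≤n r≤n with r ≤? k
-- Symmetry of the binomial coefficients, as `n ∸ k` and `k ∸ r` add up to `n ∸ r`.
... | yes r≤k = begin
  (n ∸ r) C (n ∸ k)              ≡⟨ cong ((n ∸ r) C_) n∸k≡ ⟩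
  (n ∸ r) C ((n ∸ r) ∸ (k ∸ r))  ≡⟨ nCk≡nC[n∸k] (ℕ.∸-monoˡ-≤ r k≤n) ⟨
  (n ∸ r) C (k ∸ r)              ≡⟨ cong (binom (n ∸ r)) (ℤ.⊖-≥ r≤k) ⟨
  binom (n ∸ r) (k ⊖ r)          ∎
  where
  open ≡-Reasoning
  n∸k≡ : n ∸ k ≡ (n ∸ r) ∸ (k ∸ r)
  n∸k≡ = sym (trans (ℕ.∸-+-assoc n r (k ∸ r)) (cong (n ∸_) (ℕ.m+[n∸m]≡n r≤k)))
-- Both sides vanish: on the left `n ∸ k` exceeds `n ∸ r`, on the right the lower index is negative.
... | no r≰k = trans (k>n⇒nCk≡0 (ℕ.∸-monoʳ-< k<r r≤n)) (sym (binom-⊖-< k<r))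
  where
  k<r : k < r
  k<r = ℕ.≰⇒> r≰k

  binom-⊖-< : ∀ {m j i} → j < i → binom m (j ⊖ i) ≡ 0
  -- `binom` reduces to 0 only once the index is visibly `-[1+ d ]`, so `i ∸ j` has to be exposed as
  -- a successor. The case `zero` must be refuted, since a lower index 0 would give 1.
  binom-⊖-< {m} {j} {i} j<i with i ∸ j in eq | ℤ.⊖-< j<i
  ... | zero  | _   = contradiction (ℕ.m<n⇒0<n∸m j<i) (λ 0<d → ℕ.<⇒≢ 0<d (sym eq))
  ... | suc d | j⊖i = cong (binom m) j⊖i

-- The double count of faces and subsets

theorem2 : ∀ (q n : ℕ) → 2 ≤ q → 1 ≤ n →
    ∀ (A : Subset (q ^ n)) → Nonempty A →
    ∀ (k s : ℕ) → k ≤ n → 1 ≤ s → s ≤ p q n A k →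
    sumFromTo s (p q n A k) (λ e → (e C s) * V q n A k e)
    ≡ sum (map (λ B → binom (n ∸ rank q n B) (k ⊖ rank q n B)) (subsetsOfSize A s))
theorem2 q n 2≤q _ A _ k s k≤n 1≤s _ = begin
  sumFromTo s (p q n A k) (λ e → (e C s) * V q n A k e)
    ≡⟨ cong sum (map-applyUpTo (s +_) (λ e → (e C s) * V q n A k e) len) ⟨
  sum (map (λ e → (e C s) * V q n A k e) sizes)
    ≡⟨ cong sum (map-cong (λ e → cong (λ Fs → (e C s) * length Fs)
         (filter-filter (isFace? q n k) (λ F → ∣ F ∩ A ∣ ≟ e) (allSubsets (q ^ n)))) sizes) ⟨
  sum (map (λ e → (e C s) * length (filter (λ F → ∣ F ∩ A ∣ ≟ e) 𝓕)) sizes)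
    -- Regroups the sum over sizes `e` as a sum over the faces themselves.
    ≡⟨ sum-by-value (_C s) (λ F → ∣ F ∩ A ∣) 𝓕 sizes! covered ⟩
  sum (map (λ F → ∣ F ∩ A ∣ C s) 𝓕)
    ≡⟨ cong sum (map-cong (length-subsetsOfSize-⊆ A s) 𝓕) ⟨
  sum (map (λ F → length (filter (_⊆? F) (subsetsOfSize A s))) 𝓕)
    ≡⟨ double-counting _⊆?_ (subsetsOfSize A s) 𝓕 ⟨
  sum (map (λ B → length (filter (B ⊆?_) 𝓕)) (subsetsOfSize A s))
    ≡⟨ cong sum (map-cong-local (All.tabulate λ B∈ → faces-through (∈-subsetsOfSize⁻ B∈))) ⟩
  sum (map (λ B → binom (n ∸ rank q n B) (k ⊖ rank q n B)) (subsetsOfSize A s)) ∎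
  where
  open ≡-Reasoning

  𝓕 : List (Subset (q ^ n))
  𝓕 = faces q n k

  len : ℕ
  -- The number of sizes from `s` to `p(k)`, both ends included, as in `sumFromTo`.
  len = suc (p q n A k) ∸ s

  sizes : List ℕ
  sizes = applyUpTo (s +_) len

  sizes! : Unique sizes
  sizes! = Unique.applyUpTo⁺₁ (s +_) len λ i<j _ → ℕ.<⇒≢ (ℕ.+-monoʳ-< s i<j)

  -- Sizes below `s` have binomial coefficient zero, and no size exceeds `p(k)`, because `F ∩ A`
  -- lies in `A` and in a face of at most `q ^ k` points.
  covered : ∀ {F} → F ∈ˡ 𝓕 → ∣ F ∩ A ∣ ∈ˡ sizes ⊎ ∣ F ∩ A ∣ C s ≡ 0
  covered {F} F∈ with s ≤? ∣ F ∩ A ∣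
  ... | no  s≰ = inj₂ (k>n⇒nCk≡0 (ℕ.≰⇒> s≰))
  -- The size `∣ F ∩ A ∣` stands in `sizes` at index `∣ F ∩ A ∣ ∸ s`.
  ... | yes s≤ = inj₁ (subst (_∈ˡ sizes) (ℕ.m+[n∸m]≡n s≤)
    (∈-applyUpTo⁺ (s +_) (ℕ.∸-monoˡ-< (s≤s (ℕ.⊓-glb (∣p∩q∣≤∣q∣ F A) ∣F∩A∣≤q^k)) s≤)))
    where
    ∣F∩A∣≤q^k : ∣ F ∩ A ∣ ≤ q ^ k
    ∣F∩A∣≤q^k = ℕ.≤-trans (∣p∩q∣≤∣p∣ F A)
      (∣k-face∣≤ q n (proj₂ (∈-filter⁻ (isFace? q n k) {xs = allSubsets (q ^ n)} F∈)))

  faces-through : ∀ {B} → B ⊆ A × ∣ B ∣ ≡ s →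
    length (filter (B ⊆?_) 𝓕) ≡ binom (n ∸ rank q n B) (k ⊖ rank q n B)
  -- Matching on `refl` replaces `s` by `∣ B ∣`, so `1≤s` says that `B` is non-empty and
  -- `fromℕ< 1≤s` indexes its first element, the common point of the faces.
  faces-through {B} (_ , refl) = begin
    length (filter (B ⊆?_) 𝓕)
      ≡⟨ length-faces-⊇ q n 2≤q k≤n (nth-∈ B (fromℕ< 1≤s)) ⟩
    ∣ K ∣ C (n ∸ k)             ≡⟨ cong (_C (n ∸ k)) ∣K∣≡ ⟩
    (n ∸ rank q n B) C (n ∸ k)  ≡⟨ C≡binom k≤n (∣p∣≤n (∁ K)) ⟩
    binom (n ∸ rank q n B) (k ⊖ rank q n B) ∎
    where
    K : Subset n
    K = setOf (constantOn? q n B)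

    ∣K∣≡ : ∣ K ∣ ≡ n ∸ rank q n B
    ∣K∣≡ = sym (trans (cong (n ∸_) (∣∁p∣≡n∸∣p∣ K)) (ℕ.m∸[m∸n]≡n (∣p∣≤n K)))
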